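{- Let $G$ be a connected chordal graph with maximal cliques $C_1,\dots,C_K$, and let $C$ be a maximal clique of $G$. Then $C$ is simply separated if and only if there exists a perfect sequence $C_{\pi(1)},\dots,C_{\pi(K)}$ of the maximal cliques of $G$ such that $C_{\pi(K)}=C$.
   Context: Graphs are finite, simple and undirected. Maximal cliques are regarded as subsets of the vertex set $V$; $\mathcal C=\{C_1,\dots,C_K\}$ is the set of all maximal cliques of $G$, $K=|\mathcal C|$. The symbol $\subset$ denotes proper containment. A vertex $v$ is simplicial if its set of neighbors is a clique. For $C\in\mathcal C$, $\mathrm{Simp}(C)$ is the set of simplicial vertices of $G$ lying in $C$ and $\mathrm{Sep}(C)=C\setminus\mathrm{Simp}(C)$. A maximal clique $C$ with $\mathrm{Simp}(C)\ne\emptyset$ is called simply separated (or a boundary clique) if there exists a maximal clique $C'\in\mathcal C$ with $\mathrm{Sep}(C)=C\cap C'$. For a permutation $\pi$ of $\{1,\dots,K\}$ put $S_{\pi(k)}=(C_{\pi(1)}\cup\cdots\cup C_{\pi(k-1)})\cap C_{\pi(k)}$ for $k=2,\dots,K$. The sequence $C_{\pi(1)},\dots,C_{\pi(K)}$ is a perfect sequence of the maximal cliques if for all $k\ge2$ the set $S_{\pi(k)}$ is a clique and there exists $k'<k$ with $S_{\pi(k)}\subset C_{\pi(k')}$ (running intersection property).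
   Formalization: The graph is assumed to have at least two maximal cliques (K ≥ 2); for a complete graph (K = 1) the equivalence fails, since the one-term sequence is vacuously perfect while its only maximal clique C is not simply separated. -}

module Defs where

open import Data.Nat.Base as ℕ using (ℕ; suc)
open import Data.Fin.Base using (Fin; toℕ; _<_)
open import Data.Fin.Properties using (all?; _≟_; _<?_)
open import Data.Fin.Permutation using (Permutation′; _⟨$⟩ʳ_)
open import Data.Fin.Subset using (Subset; _∈_; _⊂_; _∩_; _─_; ⋃; Nonempty)
open import Data.Fin.Subset.Properties using (_∈?_)
open import Data.List.Base using (List; allFin; filter; map)
open import Data.Product.Base using (∃-syntax; _×_)
open import Data.Sum.Base using (_⊎_)
open import Data.Vec.Base using (tabulate)
open import Function.Definitions using (Injective)
open import Level using (0ℓ)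
open import Relation.Binary.Core using (Rel)
open import Relation.Binary.Definitions using (Decidable; Symmetric; Irreflexive)
open import Relation.Binary.Construct.Closure.ReflexiveTransitive using (Star)
open import Relation.Binary.PropositionalEquality using (_≡_; _≢_)
open import Relation.Nullary.Decidable using (Dec; does; ¬?; _→-dec_)
open import Relation.Nullary.Negation using (¬_)

record Graph (n : ℕ) : Set₁ where
  field
    Adj    : Rel (Fin n) 0ℓ
    adj?   : Decidable Adj
    sym    : Symmetric Adj
    irrefl : Irreflexive _≡_ Adj

-- Successor in the cyclic order of Fin m.
Next : ∀ {m} → Fin m → Fin m → Set
Next {m} i j = toℕ j ≡ suc (toℕ i) ⊎ (suc (toℕ i) ≡ m × toℕ j ≡ 0)

module _ {n : ℕ} (G : Graph n) where
  open Graph G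

  Connected : Set
  Connected = ∀ u v → Star Adj u v

  IsCycle : ∀ {m} → (Fin m → Fin n) → Set
  IsCycle c = Injective _≡_ _≡_ c × (∀ i j → Next i j → Adj (c i) (c j))

  HasChord : ∀ {m} → (Fin m → Fin n) → Set
  HasChord c = ∃[ i ] ∃[ j ] (¬ Next i j × ¬ Next j i × Adj (c i) (c j))

  Chordal : Set
  Chordal = ∀ {m} → 4 ℕ.≤ m → (c : Fin m → Fin n) → IsCycle c → HasChord c

  -- The empty set counts as a clique.
  Clique : Subset n → Set
  Clique S = ∀ u v → u ∈ S → v ∈ S → u ≢ v → Adj u v

  clique? : ∀ S → Dec (Clique S)
  clique? S = all? λ u → all? λ v →
    (u ∈? S) →-dec ((v ∈? S) →-dec (¬? (u ≟ v) →-dec adj? u v))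

  MaximalClique : Subset n → Set
  MaximalClique S = Clique S × (∀ T → Clique T → ¬ (S ⊂ T))

  neighbours : Fin n → Subset n
  neighbours v = tabulate λ u → does (adj? v u)

  Simplicial : Fin n → Set
  Simplicial v = Clique (neighbours v)

  simplicial? : ∀ v → Dec (Simplicial v)
  simplicial? v = clique? (neighbours v)

  Simp : Subset n → Subset n
  Simp C = C ∩ tabulate λ v → does (simplicial? v)

  Sep : Subset n → Subset n
  Sep C = C ─ Simp C

  -- C′ ranges over all maximal cliques, C included. If G is complete and has
  -- a vertex, its only maximal clique C has Sep C empty and C ∩ C nonempty,
  -- so C is not simply separated.
  SimplySeparated : Subset n → Set
  SimplySeparated C =
    MaximalClique C × Nonempty (Simp C) ×
    ∃[ C′ ] (MaximalClique C′ × Sep C ≡ C ∩ C′)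

  -- 𝒞 lists every maximal clique exactly once.
  MaximalCliques : ∀ {K} → (Fin K → Subset n) → Set
  MaximalCliques 𝒞 =
    (∀ i → MaximalClique (𝒞 i)) ×
    Injective _≡_ _≡_ 𝒞 ×
    (∀ S → MaximalClique S → ∃[ i ] 𝒞 i ≡ S)

  module _ {K : ℕ} (𝒞 : Fin K → Subset n) (π : Permutation′ K) where

    earlier : Fin K → List (Fin K)
    earlier k = filter (λ j → j <? k) (allFin K)

    S : Fin K → Subset n
    S k = ⋃ (map (λ j → 𝒞 (π ⟨$⟩ʳ j)) (earlier k)) ∩ 𝒞 (π ⟨$⟩ʳ k)

    -- Positions are counted from 0, so the first one is exempt.
    PerfectSequence : Set
    PerfectSequence = ∀ k → 0 ℕ.< toℕ k →
      Clique (S k) × ∃[ k′ ] (k′ < k × S k ⊂ 𝒞 (π ⟨$⟩ʳ k′))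

    EndsWith : Subset n → Set
    EndsWith C = ∃[ k ] (suc (toℕ k) ≡ K × 𝒞 (π ⟨$⟩ʳ k) ≡ C)

{-# OPTIONS --safe #-}

-- A nonempty induced subgraph G[W] of a chordal graph has a simplicial vertex:
-- unless some vertex a is adjacent to all others, grow a connected A ∋ a for
-- as long as some vertex of W is neither in A nor adjacent to A. By maximality
-- every neighbour of A outside A is adjacent to all these far vertices. By
-- induction the far vertices contain a simplicial one b, and two nonadjacent
-- neighbours of A would form a chordless cycle with b and a shortest walk
-- through A, so b is simplicial in G[W].
-- Removing a simplicial v with neighbourhood N orders the maximal cliques of
-- G[W] by induction: if N is maximal in G[W − v] it is replaced by N ∪ {v},
-- otherwise N ∪ {v} is appended. If C is simply separated, apply this to
-- W = V ∖ Simp C, whose maximal cliques are those of G other than C, and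
-- append C. Conversely, if C comes last, a vertex of C outside the containing
-- clique C′ lies in no other maximal clique, hence is simplicial, so
-- Sep C = C ∩ C′.

module Submission where

open import Data.Bool.Base using (true; if_then_else_)
import Data.Bool.Properties as Bool
open import Data.Nat.Base using (ℕ; zero; suc; _≤_; _+_; z≤n; s≤s)
import Data.Nat.Base as ℕ
import Data.Nat.Properties as ℕ
open import Data.Nat.Induction using (<-rec)
open import Data.Fin.Base using (Fin; zero; suc; toℕ; opposite)
import Data.Fin.Base as Fin
open import Data.Fin.Properties using (all?; any?; _≟_; _<?_; toℕ-injective; toℕ<n; opposite-prop; opposite-involutive; <-cmp)
open import Data.Fin.Permutation using (Permutation′; permutation; _⟨$⟩ʳ_; _⟨$⟩ˡ_; ↔⇒≡; inverseˡ; inverseʳ)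
open import Data.Fin.Subset using (Subset; _∈_; _∉_; _⊆_; _⊈_; _⊂_; _⊃_; _∪_; _∩_; _─_; _-_; ∁; ⁅_⁆; ⊤; ⊥; ⋃; Nonempty)
open import Data.Fin.Subset.Properties
open import Data.Fin.Subset.Induction using (Acc; acc; ⊂-wellFounded; ⊃-wellFounded)
open import Data.List.Base using (List; []; _∷_; [_]; length; lookup; map; allFin)
open import Data.List.Membership.Propositional using (lose; find) renaming (_∈_ to _∈ˡ_)
open import Data.List.Membership.Propositional.Properties using (∈-map⁺; ∈-map⁻; ∈-filter⁺; ∈-filter⁻; ∈-allFin; ∈-lookup)
import Data.List.Membership.DecPropositional as DecMembership
open import Data.List.Relation.Unary.Any using (Any; here; there; index)
open import Data.List.Relation.Unary.Any.Properties using (lookup-index)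
open import Data.Product.Base using (∃; ∃-syntax; _×_; _,_; proj₁; proj₂)
open import Data.Sum.Base using (_⊎_; inj₁; inj₂)
open import Data.Vec.Base using (tabulate) renaming (_∷_ to _∷ᵛ_; here to hereᵛ; there to thereᵛ)
open import Data.Vec.Properties using (lookup∘tabulate; []=⇒lookup; lookup⇒[]=; ≡-dec)
open import Function.Base using (case_of_)
open import Function.Bundles using (_⇔_; mk⇔)
open import Relation.Binary.Construct.Closure.ReflexiveTransitive as Star using (Star; ε; _◅_; _◅◅_)
open import Relation.Binary.Definitions using (tri<; tri≈; tri>)
open import Relation.Binary.PropositionalEquality using (_≡_; _≢_; refl; sym; trans; cong; subst; subst₂; ≢-sym)
open import Relation.Nullary.Decidable using (Dec; yes; no; does; ¬?; _×-dec_; _→-dec_; dec-true; dec-false; decidable-stable)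
open import Relation.Nullary.Negation using (¬_; contradiction)
open import Relation.Unary using (Decidable)
open import Defs

-- Finite subsets: comprehension, insertion, greedy growth, unions of lists

module _ {n : ℕ} where

  module _ {P : Fin n → Set} (P? : Decidable P) where

    comprehension : Subset n
    comprehension = tabulate λ v → does (P? v)

    ∈-comprehension⁺ : ∀ {v} → P v → v ∈ comprehension
    ∈-comprehension⁺ {v} pv =
      lookup⇒[]= v _ (trans (lookup∘tabulate _ v) (dec-true (P? v) pv))

    ∈-comprehension⁻ : ∀ {v} → v ∈ comprehension → P v
    ∈-comprehension⁻ {v} v∈ with P? v | trans (sym (lookup∘tabulate _ v)) ([]=⇒lookup v∈)
    ... | yes pv | _ = pv

  ⊈⇒∃ : ∀ {p q : Subset n} → p ⊈ q → ∃[ x ] (x ∈ p × x ∉ q)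
  ⊈⇒∃ {p} {q} p⊈q with any? (λ x → (x ∈? p) ×-dec ¬? (x ∈? q))
  ... | yes found = found
  ... | no none = contradiction
    (λ {x} x∈p → decidable-stable (x ∈? q) λ x∉q → none (x , x∈p , x∉q)) p⊈q

  ∈-insert : ∀ (p : Subset n) x → x ∈ p ∪ ⁅ x ⁆
  ∈-insert p x = x∈p∪q⁺ (inj₂ (x∈⁅x⁆ x))

  ∈-insert⁻ : ∀ (p : Subset n) {x y} → y ∈ p ∪ ⁅ x ⁆ → y ∈ p ⊎ y ≡ x
  ∈-insert⁻ p {x} y∈ with x∈p∪q⁻ p ⁅ x ⁆ y∈
  ... | inj₁ y∈p = inj₁ y∈p
  ... | inj₂ y∈x = inj₂ (x∈⁅y⁆⇒x≡y x y∈x)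

  ⊆-insert : ∀ (p : Subset n) {x} → p ⊆ p ∪ ⁅ x ⁆
  ⊆-insert p = p⊆p∪q _

  ⊂-insert : ∀ {p : Subset n} {x} → x ∉ p → p ⊂ p ∪ ⁅ x ⁆
  ⊂-insert {p} {x} x∉p = ⊆-insert p , x , ∈-insert p x , x∉p

  -- Terminates because strict supersets within a finite set are well founded. It grows both the
  -- connected set of the simplicial vertex argument and cliques to maximal ones.
  saturate : {P Q : Subset n → Set} →
             (∀ A → P A → Q A ⊎ ∃[ A′ ] (A ⊂ A′ × P A′)) →
             ∀ A → P A → ∃[ B ] (A ⊆ B × P B × Q B)
  saturate {P} {Q} step A = go A (⊃-wellFounded A)
    where
    go : ∀ A → Acc _⊃_ A → P A → ∃[ B ] (A ⊆ B × P B × Q B)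
    go A (acc rec) pA with step A pA
    ... | inj₁ qA = A , (λ x∈A → x∈A) , pA , qA
    ... | inj₂ (A′ , A⊂A′ , pA′) with go A′ (rec A⊂A′) pA′
    ... | B , A′⊆B , pB , qB = B , (λ x∈A → A′⊆B (proj₁ A⊂A′ x∈A)) , pB , qB

  ∈-⋃⁺ : ∀ {x} {L : List (Subset n)} → Any (x ∈_) L → x ∈ ⋃ L
  ∈-⋃⁺ (here x∈p)  = x∈p∪q⁺ (inj₁ x∈p)
  ∈-⋃⁺ (there any) = x∈p∪q⁺ (inj₂ (∈-⋃⁺ any))

  ∈-⋃⁻ : ∀ {x} (L : List (Subset n)) → x ∈ ⋃ L → Any (x ∈_) L
  ∈-⋃⁻ []      x∈ = contradiction x∈ ∉⊥
  ∈-⋃⁻ (p ∷ L) x∈ with x∈p∪q⁻ p (⋃ L) x∈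
  ... | inj₁ x∈p = here x∈p
  ... | inj₂ x∈L = there (∈-⋃⁻ L x∈L)

x∈p─q⇒x∉q : ∀ {n} (p q : Subset n) {x} → x ∈ p ─ q → x ∉ q
x∈p─q⇒x∉q (_ ∷ᵛ p) (true ∷ᵛ q) () hereᵛ
x∈p─q⇒x∉q (_ ∷ᵛ p) (_ ∷ᵛ q) (thereᵛ x∈) (thereᵛ x∈q) = x∈p─q⇒x∉q p q x∈ x∈q

opposite-anti-< : ∀ {m} {i j : Fin m} → i Fin.< j → opposite j Fin.< opposite i
opposite-anti-< {m} {i} {j} i<j rewrite opposite-prop i | opposite-prop j =
  ℕ.∸-monoʳ-< (s≤s i<j) (toℕ<n j)

-- Walks and chordless cycles

module _ {n : ℕ} (G : Graph n) where
  open Graph G renaming (sym to adj-sym)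

  adj⇒≢ : ∀ {u v} → Adj u v → u ≢ v
  adj⇒≢ uv u≡v = irrefl u≡v uv

  -- Vertices are indexed by `ℕ`, with arbitrary values past `k`, so that cutting out a segment is
  -- plain arithmetic. Repetitions are allowed, and the endpoints need not lie in `A`.
  record Walk (A : Subset n) (x y : Fin n) (k : ℕ) (p : ℕ → Fin n) : Set where
    field
      start    : p 0 ≡ x
      end      : p k ≡ y
      step     : ∀ {i} → i ℕ.< k → Adj (p i) (p (suc i))
      interior : ∀ {i} → 0 ℕ.< i → i ℕ.< k → p i ∈ A

  consWalk : ∀ {A x a y k p} → Adj x a → a ∈ A → Walk A a y k p →
             ∃[ q ] Walk A x y (suc k) q
  consWalk {A} {x} {a} {y} {k} {p} xa a∈A w = q , record
    { start = refl ; end = end ; step = qstep ; interior = qinterior }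
    where
    open Walk w
    q : ℕ → Fin n
    q zero    = x
    q (suc i) = p i
    qstep : ∀ {i} → i ℕ.< suc k → Adj (q i) (q (suc i))
    qstep {zero}  _         = subst (Adj x) (sym start) xa
    qstep {suc i} (s≤s i<k) = step i<k
    qinterior : ∀ {i} → 0 ℕ.< i → i ℕ.< suc k → q i ∈ A
    qinterior {suc zero}    _ _         = subst (_∈ A) (sym start) a∈A
    qinterior {suc (suc i)} _ (s≤s i<k) = interior (s≤s z≤n) i<k

  StepIn : Subset n → Fin n → Fin n → Set
  StepIn A u v = Adj u v × u ∈ A × v ∈ A

  star⇒walk : ∀ {A a b y} → Star (StepIn A) a b → Adj b y →
              ∃[ k ] ∃[ p ] Walk A a y k p
  star⇒walk {a = a} {y = y} ε ay = 1 , q , record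
    { start = refl ; end = refl ; step = qstep
    ; interior = λ { {suc i} _ (s≤s ()) } }
    where
    q : ℕ → Fin n
    q zero    = a
    q (suc _) = y
    qstep : ∀ {i} → i ℕ.< 1 → Adj (q i) (q (suc i))
    qstep {zero} _ = ay
    qstep {suc i} (s≤s ())
  star⇒walk ((xa , _ , a∈A) ◅ s) by with star⇒walk s by
  ... | k , p , w with consWalk xa a∈A w
  ... | q , w′ = suc k , q , w′

  -- The chord bypasses the `e` vertices strictly between its ends, and `r` steps remain after it.
  -- Writing the length as this sum spares `detour` any subtraction.
  module _ {A : Subset n} {x y : Fin n} (i e r : ℕ) {p : ℕ → Fin n}
           (w : Walk A x y (suc i + e + r) p) (chord : Adj (p i) (p (suc i + e))) where
    open Walk w

    detour : ℕ → Fin n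
    detour t = if does (t ℕ.≤? i) then p t else p (t + e)

    detour-≤ : ∀ {t} → t ≤ i → detour t ≡ p t
    detour-≤ {t} t≤i rewrite dec-true (t ℕ.≤? i) t≤i = refl

    detour-> : ∀ {t} → i ℕ.< t → detour t ≡ p (t + e)
    detour-> {t} i<t rewrite dec-false (t ℕ.≤? i) (ℕ.<⇒≱ i<t) = refl

    private
      k≡ : suc i + r + e ≡ suc i + e + r
      k≡ = trans (ℕ.+-assoc (suc i) r e)
           (trans (cong (suc i +_) (ℕ.+-comm r e)) (sym (ℕ.+-assoc (suc i) e r)))

      k′≤k : suc i + r ≤ suc i + e + r
      k′≤k = ℕ.+-monoˡ-≤ r (ℕ.m≤m+n (suc i) e)

      shift : ∀ {t} → t ℕ.< suc i + r → t + e ℕ.< suc i + e + r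
      shift {t} t<k′ = subst (t + e ℕ.<_) k≡ (ℕ.+-monoˡ-< e t<k′)

    shortcut : Walk A x y (suc i + r) detour
    shortcut = record
      { start    = trans (detour-≤ z≤n) start
      ; end      = trans (detour-> (ℕ.m≤m+n (suc i) r)) (trans (cong p k≡) end)
      ; step     = dstep
      ; interior = dinterior
      }
      where
      dstep : ∀ {t} → t ℕ.< suc i + r → Adj (detour t) (detour (suc t))
      dstep {t} t<k′ with ℕ.<-cmp t i
      ... | tri< t<i _ _ = subst₂ Adj (sym (detour-≤ (ℕ.<⇒≤ t<i))) (sym (detour-≤ t<i))
                             (step (ℕ.<-≤-trans t<k′ k′≤k))
      ... | tri≈ _ refl _ = subst₂ Adj (sym (detour-≤ ℕ.≤-refl)) (sym (detour-> ℕ.≤-refl)) chord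
      ... | tri> _ _ i<t = subst₂ Adj (sym (detour-> i<t)) (sym (detour-> (ℕ.m<n⇒m<1+n i<t)))
                             (step (shift t<k′))
      dinterior : ∀ {t} → 0 ℕ.< t → t ℕ.< suc i + r → detour t ∈ A
      dinterior {t} 0<t t<k′ = case t ℕ.≤? i of λ where
        (yes t≤i) → subst (_∈ A) (sym (detour-≤ t≤i)) (interior 0<t (ℕ.<-≤-trans t<k′ k′≤k))
        (no t≰i)  → subst (_∈ A) (sym (detour-> (ℕ.≰⇒> t≰i)))
                      (interior (ℕ.<-≤-trans 0<t (ℕ.m≤m+n t e)) (shift t<k′))

  -- A shortest walk from x to y through A would close up, through b, to a
  -- chordless cycle.
  module _ (chordal : Chordal G) {A : Subset n} {x y b : Fin n}
           (x≢y : x ≢ y) (¬xy : ¬ Adj x y) (y∉A : y ∉ A)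
           (bx : Adj b x) (by : Adj b y) (b∉A : b ∉ A) (b≁A : ∀ {a} → a ∈ A → ¬ Adj b a) where

    private
      NoWalk : ℕ → Set
      NoWalk k = ∀ p → ¬ Walk A x y k p

      -- Minimality enters as `rec`: shorter walks are already excluded by strong induction, so no
      -- shortest walk has to be selected.
      module Shortest (k : ℕ) (rec : ∀ {k′} → k′ ℕ.< suc (suc k) → NoWalk k′)
                      (p : ℕ → Fin n) (w : Walk A x y (suc (suc k)) p) where
        open Walk w

        ¬chord : ∀ {i j} → suc i ℕ.< j → j ≤ suc (suc k) → ¬ Adj (p i) (p j)
        ¬chord {i} {j} si<j j≤k pipj with ℕ.m≤n⇒∃[o]m+o≡n (ℕ.<⇒≤ si<j) | ℕ.m≤n⇒∃[o]m+o≡n j≤k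
        -- Here `e` is the difference of `j` and `suc i`; it is positive, so the detour is strictly
        -- shorter.
        ... | e , refl | r , k≡ = rec shorter (detour i e r w′ pipj) (shortcut i e r w′ pipj)
          where
          w′ = subst (λ k → Walk A x y k p) (sym k≡) w
          shorter : suc i + r ℕ.< suc (suc k)
          shorter = subst (suc i + r ℕ.<_) k≡
            (ℕ.+-monoˡ-< r {suc i} si<j)

        -- If `j` is not the end, equality would make the edge from `p j` to `p (suc j)` a chord
        -- leaving `p i`. At the end, `i = 0` contradicts `x≢y`, and any other `p i` lies in `A`
        -- while `y` does not.
        p-≢ : ∀ {i j} → i ℕ.< j → j ≤ suc (suc k) → p i ≢ p j
        p-≢ {i} {j} i<j j≤k pi≡pj with ℕ.m≤n⇒m<n∨m≡n j≤k
        ... | inj₁ j<k = ¬chord (s≤s i<j) j<k (subst (λ v → Adj v (p (suc j))) (sym pi≡pj) (step j<k))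
        p-≢ {zero}  i<j j≤k pi≡pj | inj₂ refl = x≢y (trans (sym start) (trans pi≡pj end))
        p-≢ {suc i} i<j j≤k pi≡pj | inj₂ refl =
          y∉A (subst (_∈ A) (trans pi≡pj end) (interior (s≤s z≤n) i<j))

        p-injective : ∀ {i j} → i ≤ suc (suc k) → j ≤ suc (suc k) → p i ≡ p j → i ≡ j
        p-injective {i} {j} i≤k j≤k eq with ℕ.<-cmp i j
        ... | tri< i<j _ _ = contradiction eq (p-≢ i<j j≤k)
        ... | tri≈ _ i≡j _ = i≡j
        ... | tri> _ _ j<i = contradiction (sym eq) (p-≢ j<i i≤k)

        position : ∀ i → i ≤ suc (suc k) → i ≡ 0 ⊎ i ≡ suc (suc k) ⊎ p i ∈ A
        position zero    _   = inj₁ refl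
        position (suc i) i≤k with ℕ.m≤n⇒m<n∨m≡n i≤k
        ... | inj₁ i<k = inj₂ (inj₂ (interior (s≤s z≤n) i<k))
        ... | inj₂ i≡k = inj₂ (inj₁ i≡k)

        b≢p : ∀ {i} → i ≤ suc (suc k) → b ≢ p i
        b≢p {i} i≤k b≡pi with position i i≤k
        ... | inj₁ refl        = adj⇒≢ bx (trans b≡pi start)
        ... | inj₂ (inj₁ refl) = adj⇒≢ by (trans b≡pi end)
        ... | inj₂ (inj₂ pi∈A) = b∉A (subst (_∈ A) (sym b≡pi) pi∈A)

        bound : (i : Fin (suc (suc (suc k)))) → toℕ i ≤ suc (suc k)
        bound i = ℕ.≤-pred (toℕ<n i)

        -- `b` is followed by the `k + 3` vertices of the walk, which has length at least 2; hence
        -- the 4 vertices that `Chordal` asks for.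
        cycle : Fin (suc (suc (suc (suc k)))) → Fin n
        cycle zero    = b
        cycle (suc i) = p (toℕ i)

        cycle-injective : ∀ {i j} → cycle i ≡ cycle j → i ≡ j
        cycle-injective {zero}  {zero}  eq = refl
        cycle-injective {zero}  {suc j} eq = contradiction eq (b≢p (bound j))
        cycle-injective {suc i} {zero}  eq = contradiction (sym eq) (b≢p (bound i))
        cycle-injective {suc i} {suc j} eq =
          cong suc (toℕ-injective (p-injective (bound i) (bound j) eq))

        cycle-step : ∀ i j → Next i j → Adj (cycle i) (cycle j)
        cycle-step zero zero (inj₁ ())
        cycle-step zero zero (inj₂ (() , _))
        cycle-step zero (suc j) (inj₁ eq) =
          subst (Adj b) (trans (sym start) (cong p (sym (ℕ.suc-injective eq)))) bx
        cycle-step zero (suc j) (inj₂ (() , _))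
        cycle-step (suc i) zero (inj₁ ())
        cycle-step (suc i) zero (inj₂ (eq , _)) =
          adj-sym (subst (Adj b) (trans (sym end) (cong p (sym (ℕ.suc-injective (ℕ.suc-injective eq))))) by)
        cycle-step (suc i) (suc j) (inj₁ eq) =
          subst (λ t → Adj (p (toℕ i)) (p t)) (sym j≡) (step (subst (_≤ suc (suc k)) j≡ (bound j)))
          where j≡ = ℕ.suc-injective eq
        cycle-step (suc i) (suc j) (inj₂ (_ , ()))

        b-nonadjacent : ∀ j → ¬ Next zero (suc j) → ¬ Next (suc j) zero → ¬ Adj b (cycle (suc j))
        b-nonadjacent j ¬next ¬prev with position (toℕ j) (bound j)
        ... | inj₁ j≡0        = λ _ → ¬next (inj₁ (cong suc j≡0))
        ... | inj₂ (inj₁ j≡k) = λ _ → ¬prev (inj₂ (cong (λ t → suc (suc t)) j≡k , refl))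
        ... | inj₂ (inj₂ pj∈A) = b≁A pj∈A

        p-nonadjacent : ∀ i j → toℕ i ℕ.< toℕ j → ¬ Next (suc i) (suc j) → ¬ Adj (p (toℕ i)) (p (toℕ j))
        p-nonadjacent i j i<j ¬next with ℕ.m≤n⇒m<n∨m≡n i<j
        ... | inj₁ si<j = ¬chord si<j (bound j)
        ... | inj₂ si≡j = λ _ → ¬next (inj₁ (cong suc (sym si≡j)))

        chordless : ¬ HasChord G cycle
        chordless (zero  , zero  , _ , _ , bb) = adj⇒≢ bb refl
        chordless (zero  , suc j , ¬next , ¬prev , bj) = b-nonadjacent j ¬next ¬prev bj
        chordless (suc i , zero  , ¬next , ¬prev , ib) = b-nonadjacent i ¬prev ¬next (adj-sym ib)
        chordless (suc i , suc j , ¬next , ¬prev , ij) with ℕ.<-cmp (toℕ i) (toℕ j)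
        ... | tri< i<j _ _ = p-nonadjacent i j i<j ¬next ij
        ... | tri≈ _ i≡j _ = adj⇒≢ ij (cong p i≡j)
        ... | tri> _ _ j<i = p-nonadjacent j i j<i ¬prev (adj-sym ij)

        impossible : ∀ {ℓ} {X : Set ℓ} → X
        impossible = contradiction
          (chordal (s≤s (s≤s (s≤s (s≤s z≤n)))) cycle (cycle-injective , cycle-step)) chordless

    noWalk : ∀ k p → ¬ Walk A x y k p
    -- Lengths 0 and 1 would make `x` and `y` equal or adjacent; from length 2 on the cycle argument
    -- applies.
    noWalk = <-rec NoWalk λ where
      zero          _   p w → x≢y (trans (sym (Walk.start w)) (Walk.end w))
      (suc zero)    _   p w → ¬xy (subst₂ Adj (Walk.start w) (Walk.end w) (Walk.step w (s≤s z≤n)))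
      (suc (suc k)) rec p w → Shortest.impossible k rec p w

  -- Existence of a simplicial vertex

  SimplicialIn : Subset n → Fin n → Set
  SimplicialIn W v = v ∈ W ×
    (∀ {u w} → u ∈ W → w ∈ W → Adj v u → Adj v w → u ≢ w → Adj u w)

  Connects : Fin n → Subset n → Set
  Connects a A = ∀ {u} → u ∈ A → Star (StepIn A) a u

  Touches : Subset n → Fin n → Set
  Touches A x = ∃[ a ] (a ∈ A × Adj x a)

  touches? : ∀ A → Decidable (Touches A)
  touches? A x = any? λ a → (a ∈? A) ×-dec adj? x a

  Far : Subset n → Subset n → Fin n → Set
  Far W A c = c ∈ W × c ∉ A × ¬ Touches A c

  far? : ∀ W A → Decidable (Far W A)
  far? W A c = (c ∈? W) ×-dec (¬? (c ∈? A) ×-dec ¬? (touches? A c))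

  stepIn-insert : ∀ {A x u v} → StepIn A u v → StepIn (A ∪ ⁅ x ⁆) u v
  stepIn-insert {A} (uv , u∈A , v∈A) = uv , ⊆-insert A u∈A , ⊆-insert A v∈A

  connects-insert : ∀ {a A x} → Connects a A → Touches A x → Connects a (A ∪ ⁅ x ⁆)
  connects-insert {a} {A} {x} conn (a′ , a′∈A , xa′) u∈ with ∈-insert⁻ A u∈
  ... | inj₁ u∈A  = Star.map stepIn-insert (conn u∈A)
  ... | inj₂ refl = Star.map stepIn-insert (conn a′∈A) ◅◅
    ((adj-sym xa′ , ⊆-insert A a′∈A , ∈-insert A x) ◅ ε)

  module _ (W : Subset n) (a : Fin n) where

    Separating : Subset n → Set
    Separating A = a ∈ A × Connects a A × ∃ (Far W A)

    BoundaryComplete : Subset n → Set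
    BoundaryComplete A = ∀ {x c} → x ∈ W → x ∉ A → Touches A x → Far W A c → Adj x c

    -- If a boundary vertex `x` misses a far vertex `c`, then `A` can take in `x`: it stays
    -- connected, and `c` remains far because it is not adjacent to `x`.
    enlarge : ∀ A → Separating A →
              BoundaryComplete A ⊎ ∃[ A′ ] (A ⊂ A′ × Separating A′)
    enlarge A (a∈A , conn , _) with any? (λ x → any? (λ c →
      (x ∈? W) ×-dec (¬? (x ∈? A) ×-dec (touches? A x ×-dec (far? W A c ×-dec ¬? (adj? x c))))))
    ... | no none = inj₁ λ {x} {c} x∈W x∉A tx fc → decidable-stable (adj? x c)
                      λ ¬xc → none (x , c , x∈W , x∉A , tx , fc , ¬xc)
    ... | yes (x , c , x∈W , x∉A , tx , (c∈W , c∉A , ¬tc) , ¬xc) = inj₂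
      (A ∪ ⁅ x ⁆ , ⊂-insert x∉A , ⊆-insert A a∈A , connects-insert conn tx
      , c , c∈W , c∉A′ , ¬tc′)
      where
      c∉A′ : c ∉ A ∪ ⁅ x ⁆
      c∉A′ c∈ with ∈-insert⁻ A c∈
      ... | inj₁ c∈A  = c∉A c∈A
      ... | inj₂ refl = ¬tc tx
      ¬tc′ : ¬ Touches (A ∪ ⁅ x ⁆) c
      ¬tc′ (d , d∈ , cd) with ∈-insert⁻ A d∈
      ... | inj₁ d∈A  = ¬tc (d , d∈A , cd)
      ... | inj₂ refl = ¬xc (adj-sym cd)

  ∃-simplicial : Chordal G → ∀ W → Nonempty W → ∃ (SimplicialIn W)
  ∃-simplicial chordal W = go W (⊂-wellFounded W)
    where
    go : ∀ W → Acc _⊂_ W → Nonempty W → ∃ (SimplicialIn W)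
    go W (acc rec) (a , a∈W) with any? (λ b → (b ∈? W) ×-dec (¬? (b ≟ a) ×-dec ¬? (adj? b a)))
    -- Here `a` is adjacent to all other vertices of `W`, so a simplicial vertex of `W - a` stays
    -- simplicial in `W`; if `W - a` is empty, `a` itself qualifies.
    ... | no none = universal (nonempty? (W - a))
      where
      joined : ∀ {u} → u ∈ W → u ≢ a → Adj u a
      joined {u} u∈W u≢a = decidable-stable (adj? u a) λ ¬ua → none (u , u∈W , u≢a , ¬ua)
      universal : Dec (Nonempty (W - a)) → ∃ (SimplicialIn W)
      universal (no empty) = a , a∈W , λ {u} u∈W _ au _ _ →
        contradiction (u , x∈p∧x≢y⇒x∈p-y u∈W (≢-sym (adj⇒≢ au))) empty
      universal (yes ne) with go (W - a) (rec (x∈p⇒p-x⊂p a∈W)) ne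
      ... | v , v∈ , simp = v , p─q⊆p W ⁅ a ⁆ v∈ , simp′
        where
        simp′ : ∀ {u w} → u ∈ W → w ∈ W → Adj v u → Adj v w → u ≢ w → Adj u w
        simp′ {u} {w} u∈W w∈W vu vw u≢w with u ≟ a | w ≟ a
        ... | yes refl | _        = adj-sym (joined w∈W (≢-sym u≢w))
        ... | no _     | yes refl = joined u∈W u≢w
        ... | no u≢a   | no w≢a   =
          simp (x∈p∧x≢y⇒x∈p-y u∈W u≢a) (x∈p∧x≢y⇒x∈p-y w∈W w≢a) vu vw u≢w
    ... | yes (b , b∈W , b≢a , ¬ba)
      -- Growth starts from the singleton of `a`, for which the nonneighbour `b` is far.
      with saturate {Q = BoundaryComplete W a} (enlarge W a) ⁅ a ⁆
             (x∈⁅x⁆ a , (λ u∈ → subst (Star _ a) (sym (x∈⁅y⁆⇒x≡y a u∈)) ε) , b , b∈W , x≢y⇒x∉⁅y⁆ b≢a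
             , λ { (d , d∈ , bd) → ¬ba (subst (Adj b) (x∈⁅y⁆⇒x≡y a d∈) bd) })
    ... | A , _ , (a∈A , conn , c , farc) , complete
      -- The far vertices omit `a`, so the induction hypothesis applies to them; `c` shows that
      -- there are some.
      with go B (rec B⊂W) (c , ∈-comprehension⁺ (far? W A) farc)
      where
      B = comprehension (far? W A)
      B⊂W : B ⊂ W
      B⊂W = (λ u∈B → proj₁ (∈-comprehension⁻ (far? W A) u∈B)) , a , a∈W
          , λ a∈B → proj₁ (proj₂ (∈-comprehension⁻ (far? W A) a∈B)) a∈A
    ... | v , v∈B , simp with ∈-comprehension⁻ (far? W A) v∈B
    ... | farv@(v∈W , v∉A , ¬tv) = v , v∈W , simp′
      where
      ∉A : ∀ {u} → Adj v u → u ∉ A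
      ∉A {u} vu u∈A = ¬tv (u , u∈A , vu)
      linked : ∀ {u w} → Touches A u → Touches A w →
               ∃[ k ] ∃[ p ] Walk A u w k p
      linked (d , d∈A , ud) (e , e∈A , we)
        -- The route leads from `u` to its contact `d`, back to `a`, out to `e` and on to `w`.
        with star⇒walk (Star.reverse (λ (st , s∈ , t∈) → adj-sym st , t∈ , s∈) (conn d∈A) ◅◅ conn e∈A) (adj-sym we)
      ... | k , p , walk = suc k , consWalk ud d∈A walk
      simp′ : ∀ {u w} → u ∈ W → w ∈ W → Adj v u → Adj v w → u ≢ w → Adj u w
      -- A neighbour of `v` in `W` is far or touches `A`. Two far ones are settled by the choice of
      -- `v`, a mixed pair by boundary completeness, two touching ones by `noWalk` with `v` in the
      -- role of `b`.
      simp′ {u} {w} u∈W w∈W vu vw u≢w with touches? A u | touches? A w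
      ... | no ¬tu | no ¬tw = simp (∈-comprehension⁺ (far? W A) (u∈W , ∉A vu , ¬tu))
                                   (∈-comprehension⁺ (far? W A) (w∈W , ∉A vw , ¬tw)) vu vw u≢w
      ... | yes tu | no ¬tw = complete u∈W (∉A vu) tu (w∈W , ∉A vw , ¬tw)
      ... | no ¬tu | yes tw = adj-sym (complete w∈W (∉A vw) tw (u∈W , ∉A vu , ¬tu))
      ... | yes tu | yes tw = decidable-stable (adj? u w) λ ¬uw →
        let k , p , walk = linked tu tw in
        noWalk chordal u≢w ¬uw (∉A vw) vu vw v∉A (λ a∈A va → ¬tv (_ , a∈A , va)) k p walk

  -- Cliques maximal within a vertex set

  Extends : Subset n → Fin n → Set
  Extends T x = ∀ u → u ∈ T → u ≢ x → Adj u x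

  extends? : ∀ T → Decidable (Extends T)
  extends? T x = all? λ u → (u ∈? T) →-dec (¬? (u ≟ x) →-dec adj? u x)

  clique-insert : ∀ {T x} → Clique G T → Extends T x → Clique G (T ∪ ⁅ x ⁆)
  clique-insert {T} clique ext u w u∈ w∈ u≢w with ∈-insert⁻ T u∈ | ∈-insert⁻ T w∈
  ... | inj₁ u∈T  | inj₁ w∈T  = clique u w u∈T w∈T u≢w
  ... | inj₁ u∈T  | inj₂ refl = ext u u∈T u≢w
  ... | inj₂ refl | inj₁ w∈T  = adj-sym (ext w w∈T (≢-sym u≢w))
  ... | inj₂ refl | inj₂ refl = contradiction refl u≢w

  clique⇒extends : ∀ {S T x} → Clique G S → T ⊆ S → x ∈ S → Extends T x
  clique⇒extends clique T⊆S x∈S u u∈T = clique u _ (T⊆S u∈T) x∈S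

  -- Like `SimplicialIn`, stated inside the ambient `G`, so that inductions on `W` need no induced
  -- graphs. Testing single vertices instead of larger cliques keeps the greedy extension decidable;
  -- for `W = ⊤` it agrees with `MaximalClique`.
  MaximalIn : Subset n → Subset n → Set
  MaximalIn W T = T ⊆ W × Clique G T × (∀ x → x ∈ W → Extends T x → x ∈ T)

  maximalIn⇒≡ : ∀ {W S T} → MaximalIn W T → Clique G S → S ⊆ W → T ⊆ S → T ≡ S
  maximalIn⇒≡ (_ , _ , closed) clique S⊆W T⊆S = ⊆-antisym T⊆S
    λ {x} x∈S → closed x (S⊆W x∈S) (clique⇒extends clique T⊆S x∈S)

  maximalIn⇒maximal : ∀ {T} → MaximalIn ⊤ T → MaximalClique G T
  maximalIn⇒maximal (_ , clique , closed) = clique , λ S cliqueS (T⊆S , x , x∈S , x∉T) →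
    x∉T (closed x ∈⊤ (clique⇒extends cliqueS T⊆S x∈S))

  maximal⇒maximalIn : ∀ {T} → MaximalClique G T → MaximalIn ⊤ T
  maximal⇒maximalIn {T} (clique , maximal) = ⊆⊤ , clique , λ x _ ext →
    decidable-stable (x ∈? T) λ x∉T → maximal (T ∪ ⁅ x ⁆) (clique-insert clique ext) (⊂-insert x∉T)

  maximal⇒≡ : ∀ {S T} → MaximalClique G T → Clique G S → T ⊆ S → T ≡ S
  maximal⇒≡ maximal clique = maximalIn⇒≡ (maximal⇒maximalIn maximal) clique ⊆⊤

  extendClique : ∀ W S → Clique G S → S ⊆ W → ∃[ D ] (S ⊆ D × MaximalIn W D)
  extendClique W S clique S⊆W with saturate grow S (clique , λ {x} → S⊆W {x})
    where
    grow : ∀ A → Clique G A × A ⊆ W →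
           (∀ x → x ∈ W → Extends A x → x ∈ A) ⊎ ∃[ A′ ] (A ⊂ A′ × Clique G A′ × A′ ⊆ W)
    grow A (cliqueA , A⊆W) with any? (λ x → (x ∈? W) ×-dec (extends? A x ×-dec ¬? (x ∈? A)))
    ... | no none = inj₁ λ x x∈W ext → decidable-stable (x ∈? A) λ x∉A → none (x , x∈W , ext , x∉A)
    ... | yes (x , x∈W , ext , x∉A) =
      inj₂ (A ∪ ⁅ x ⁆ , ⊂-insert x∉A , clique-insert cliqueA ext , insert⊆W)
      where
      insert⊆W : A ∪ ⁅ x ⁆ ⊆ W
      insert⊆W u∈ with ∈-insert⁻ A u∈
      ... | inj₁ u∈A  = A⊆W u∈A
      ... | inj₂ refl = x∈W
  ... | D , S⊆D , (cliqueD , D⊆W) , closed = D , S⊆D , D⊆W , cliqueD , closed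

  edge⊆maximal : ∀ {u v} → Adj u v → ∃[ D ] (MaximalClique G D × u ∈ D × v ∈ D)
  edge⊆maximal {u} {v} uv
    with extendClique ⊤ (⁅ u ⁆ ∪ ⁅ v ⁆) (clique-insert singleton extends) ⊆⊤
    where
    singleton : Clique G ⁅ u ⁆
    singleton s t s∈ t∈ s≢t = contradiction (trans (x∈⁅y⁆⇒x≡y u s∈) (sym (x∈⁅y⁆⇒x≡y u t∈))) s≢t
    extends : Extends ⁅ u ⁆ v
    extends s s∈ _ = subst (λ s → Adj s v) (sym (x∈⁅y⁆⇒x≡y u s∈)) uv
  ... | D , ⊆D , maxD = D , maximalIn⇒maximal maxD
    , ⊆D (⊆-insert ⁅ u ⁆ (x∈⁅x⁆ u)) , ⊆D (∈-insert ⁅ u ⁆ v)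

-- Lists of sets with running intersections

_≟ˢ_ : ∀ {n} (p q : Subset n) → Dec (p ≡ q)
_≟ˢ_ = ≡-dec Bool._≟_

-- The head of the list is the last set of the sequence; D ⊈ D′ rules out repetitions.
data RunningIntersection {n} : List (Subset n) → Set where
  single : ∀ D → RunningIntersection [ D ]
  extend : ∀ {D L} D′ → D′ ∈ˡ L → D ⊈ D′ →
           (∀ E → E ∈ˡ L → ∀ {u} → u ∈ E → u ∈ D → u ∈ D′) →
           RunningIntersection L → RunningIntersection (D ∷ L)

module _ {n : ℕ} (N : Subset n) (v : Fin n) where

  absorb : Subset n → Subset n
  absorb E = if does (E ≟ˢ N) then N ∪ ⁅ v ⁆ else E

  absorb-≡ : absorb N ≡ N ∪ ⁅ v ⁆
  absorb-≡ rewrite dec-true (N ≟ˢ N) refl = refl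

  absorb-≢ : ∀ {E} → E ≢ N → absorb E ≡ E
  absorb-≢ {E} E≢N rewrite dec-false (E ≟ˢ N) E≢N = refl

  absorb-⊇ : ∀ E → E ⊆ absorb E
  absorb-⊇ E u∈E with E ≟ˢ N
  ... | yes refl = ⊆-insert N u∈E
  ... | no _     = u∈E

  absorb-∈⁻ : ∀ E {u} → u ∈ absorb E → u ∈ E ⊎ (E ≡ N × u ≡ v)
  absorb-∈⁻ E u∈ with E ≟ˢ N
  ... | no _     = inj₁ u∈
  ... | yes refl with ∈-insert⁻ N u∈
  ...   | inj₁ u∈N = inj₁ u∈N
  ...   | inj₂ u≡v = inj₂ (refl , u≡v)

  -- Since `v` is new and `N` occurs at most once, `v` lies in at most one member of the new list,
  -- so no intersection of two members gains a vertex.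
  absorb-runningIntersection : ∀ {L} → (∀ E → E ∈ˡ L → v ∉ E) →
    RunningIntersection L → RunningIntersection (map absorb L)
  absorb-runningIntersection v∉ (single D) = single (absorb D)
  absorb-runningIntersection v∉ (extend {D} {L} D′ D′∈L D⊈D′ rip r) =
    extend (absorb D′) (∈-map⁺ absorb D′∈L) ⊈′ rip′
      (absorb-runningIntersection (λ E E∈L → v∉ E (there E∈L)) r)
    where
    -- Otherwise the running intersection clause for `E = D` would put all of `D` inside `D′`.
    D∉L : ¬ D ∈ˡ L
    D∉L D∈L = D⊈D′ λ u∈D → rip D D∈L u∈D u∈D
    ⊈′ : absorb D ⊈ absorb D′
    ⊈′ ⊆′ with ⊈⇒∃ D⊈D′
    ... | w , w∈D , w∉D′ with absorb-∈⁻ D′ (⊆′ (absorb-⊇ D w∈D))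
    ... | inj₁ w∈D′ = w∉D′ w∈D′
    ... | inj₂ (_ , refl) = v∉ D (here refl) w∈D
    rip′ : ∀ F → F ∈ˡ map absorb L → ∀ {u} → u ∈ F → u ∈ absorb D → u ∈ absorb D′
    rip′ F F∈ u∈F u∈D with ∈-map⁻ absorb F∈
    ... | E , E∈L , refl with absorb-∈⁻ E u∈F | absorb-∈⁻ D u∈D
    ... | inj₁ u∈E           | inj₁ u∈D           = absorb-⊇ D′ (rip E E∈L u∈E u∈D)
    ... | inj₁ u∈E           | inj₂ (_ , refl)    = contradiction u∈E (v∉ E (there E∈L))
    ... | inj₂ (_ , refl)    | inj₁ u∈D           = contradiction u∈D (v∉ D (here refl))
    ... | inj₂ (refl , refl) | inj₂ (refl , _)    = contradiction E∈L D∉L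

-- Maximal cliques when a simplicial vertex is put back

module _ {n : ℕ} (G : Graph n) where
  open Graph G renaming (sym to adj-sym)

  ListsMaximal : Subset n → List (Subset n) → Set
  ListsMaximal W L = ∀ T → (MaximalIn G W T → T ∈ˡ L) × (T ∈ˡ L → MaximalIn G W T)

  module Removal {W : Subset n} {v : Fin n} (simplicial : SimplicialIn G W v) where

    v∈W = proj₁ simplicial

    W⁻ : Subset n
    W⁻ = W - v

    N? : Decidable (λ u → u ∈ W × Adj v u)
    N? u = (u ∈? W) ×-dec adj? v u

    N : Subset n
    N = comprehension N?

    N⁺ : Subset n
    N⁺ = N ∪ ⁅ v ⁆

    W⁻⊆W : W⁻ ⊆ W
    W⁻⊆W = p─q⊆p W ⁅ v ⁆

    v∉W⁻ : v ∉ W⁻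
    v∉W⁻ v∈ = x∈p─q⇒x∉q W ⁅ v ⁆ v∈ (x∈⁅x⁆ v)

    ∈-N⁺ : ∀ {u} → u ∈ W → Adj v u → u ∈ N
    ∈-N⁺ u∈W vu = ∈-comprehension⁺ N? (u∈W , vu)

    ∈-N⁻ : ∀ {u} → u ∈ N → u ∈ W × Adj v u
    ∈-N⁻ = ∈-comprehension⁻ N?

    N⊆W⁻ : N ⊆ W⁻
    N⊆W⁻ u∈N = let u∈W , vu = ∈-N⁻ u∈N in x∈p∧x≢y⇒x∈p-y u∈W (≢-sym (adj⇒≢ G vu))

    N-clique : Clique G N
    N-clique u w u∈N w∈N u≢w =
      let u∈W , vu = ∈-N⁻ u∈N ; w∈W , vw = ∈-N⁻ w∈N in proj₂ simplicial u∈W w∈W vu vw u≢w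

    N⁺-clique : Clique G N⁺
    N⁺-clique = clique-insert G N-clique λ u u∈N _ → adj-sym (proj₂ (∈-N⁻ u∈N))

    N⁺⊆W : N⁺ ⊆ W
    N⁺⊆W u∈ with ∈-insert⁻ N u∈
    ... | inj₁ u∈N  = proj₁ (∈-N⁻ u∈N)
    ... | inj₂ refl = v∈W

    N⁺-maximal : MaximalIn G W N⁺
    N⁺-maximal = N⁺⊆W , N⁺-clique , closed
      where
      closed : ∀ x → x ∈ W → Extends G N⁺ x → x ∈ N⁺
      closed x x∈W ext with v ≟ x
      ... | yes refl = ∈-insert N v
      ... | no v≢x   = ⊆-insert N (∈-N⁺ x∈W (ext v (∈-insert N v) v≢x))

    -- A clique in `W` through `v` lies inside `N⁺`, so a maximal one equals `N⁺`, and every other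
    -- maximal clique avoids `v`. It cannot be `N`, which `v` would extend.
    maximalIn-W⁻ : ∀ {T} → MaximalIn G W T → T ≢ N⁺ → MaximalIn G W⁻ T × T ≢ N
    maximalIn-W⁻ {T} max@(T⊆W , clique , closed) T≢N⁺ =
      (T⊆W⁻ , clique , λ x x∈ → closed x (W⁻⊆W x∈)) , T≢N
      where
      v∉T : v ∉ T
      v∉T v∈T = T≢N⁺ (maximalIn⇒≡ G max N⁺-clique N⁺⊆W T⊆N⁺)
        where
        T⊆N⁺ : T ⊆ N⁺
        T⊆N⁺ {u} u∈T with u ≟ v
        ... | yes refl = ∈-insert N v
        ... | no u≢v   = ⊆-insert N (∈-N⁺ (T⊆W u∈T) (clique v u v∈T u∈T (≢-sym u≢v)))
      T⊆W⁻ : T ⊆ W⁻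
      T⊆W⁻ {u} u∈T = x∈p∧x≢y⇒x∈p-y (T⊆W u∈T) λ { refl → v∉T u∈T }
      T≢N : T ≢ N
      T≢N refl = v∉T (closed v v∈W λ u u∈N _ → adj-sym (proj₂ (∈-N⁻ u∈N)))

    -- Only `v` could newly extend `T`, but then `T ⊆ N`, and maximality in `W⁻` gives `T ≡ N`.
    maximalIn-W : ∀ {T} → MaximalIn G W⁻ T → T ≢ N → MaximalIn G W T
    maximalIn-W {T} max@(T⊆W⁻ , clique , closed) T≢N =
      (λ u∈T → W⁻⊆W (T⊆W⁻ u∈T)) , clique , closed′
      where
      closed′ : ∀ x → x ∈ W → Extends G T x → x ∈ T
      closed′ x x∈W ext with x ≟ v
      ... | no x≢v   = closed x (x∈p∧x≢y⇒x∈p-y x∈W x≢v) ext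
      ... | yes refl = contradiction (maximalIn⇒≡ G max N-clique N⊆W⁻ T⊆N) T≢N
        where
        T⊆N : T ⊆ N
        T⊆N {u} u∈T = ∈-N⁺ (W⁻⊆W (T⊆W⁻ u∈T))
          (adj-sym (ext u u∈T λ { refl → v∉W⁻ (T⊆W⁻ u∈T) }))

    open DecMembership (_≟ˢ_ {n}) using () renaming (_∈?_ to _∈ˡ?_)

    restore : ∀ {L} → RunningIntersection L → ListsMaximal W⁻ L →
              ∃[ L′ ] (RunningIntersection L′ × ListsMaximal W L′)
    restore {L} rip lists with N ∈ˡ? L
    ... | yes N∈L = map f L , absorb-runningIntersection N v v∉ rip , λ T → to T , from T
      where
      f = absorb N v
      v∉ : ∀ E → E ∈ˡ L → v ∉ E
      v∉ E E∈L v∈E = v∉W⁻ (proj₁ (proj₂ (lists E) E∈L) v∈E)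
      to : ∀ T → MaximalIn G W T → T ∈ˡ map f L
      to T max with T ≟ˢ N⁺
      ... | yes refl = subst (_∈ˡ map f L) (absorb-≡ N v) (∈-map⁺ f N∈L)
      ... | no T≢N⁺  = let max⁻ , T≢N = maximalIn-W⁻ max T≢N⁺ in
        subst (_∈ˡ map f L) (absorb-≢ N v T≢N) (∈-map⁺ f (proj₁ (lists T) max⁻))
      from : ∀ T → T ∈ˡ map f L → MaximalIn G W T
      from T T∈ with ∈-map⁻ f T∈
      ... | E , E∈L , refl with E ≟ˢ N
      ... | yes refl = N⁺-maximal
      ... | no E≢N   = maximalIn-W (proj₂ (lists E) E∈L) E≢N
    -- As `N` is not maximal in `W⁻`, it sits inside a maximal `D`, which meets `N⁺` exactly in `N`
    -- and so can serve as its container.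
    ... | no N∉L with extendClique G W⁻ N N-clique N⊆W⁻
    ... | D , N⊆D , maxD = N⁺ ∷ L , extend D (proj₁ (lists D) maxD) N⁺⊈D rip⁺ rip , λ T → to T , from T
      where
      N⁺⊈D : N⁺ ⊈ D
      N⁺⊈D N⁺⊆D = v∉W⁻ (proj₁ maxD (N⁺⊆D (∈-insert N v)))
      rip⁺ : ∀ E → E ∈ˡ L → ∀ {u} → u ∈ E → u ∈ N⁺ → u ∈ D
      rip⁺ E E∈L u∈E u∈N⁺ with ∈-insert⁻ N u∈N⁺
      ... | inj₁ u∈N  = N⊆D u∈N
      ... | inj₂ refl = contradiction (proj₁ (proj₂ (lists E) E∈L) u∈E) v∉W⁻
      to : ∀ T → MaximalIn G W T → T ∈ˡ N⁺ ∷ L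
      to T max with T ≟ˢ N⁺
      ... | yes T≡N⁺ = here T≡N⁺
      ... | no T≢N⁺  = there (proj₁ (lists T) (proj₁ (maximalIn-W⁻ max T≢N⁺)))
      from : ∀ T → T ∈ˡ N⁺ ∷ L → MaximalIn G W T
      from T (here refl) = N⁺-maximal
      from T (there T∈L) = maximalIn-W (proj₂ (lists T) T∈L) λ { refl → N∉L T∈L }

  perfectList : Chordal G → ∀ W → ∃[ L ] (RunningIntersection L × ListsMaximal W L)
  perfectList chordal W = go W (⊂-wellFounded W)
    where
    go : ∀ W → Acc _⊂_ W → ∃[ L ] (RunningIntersection L × ListsMaximal W L)
    go W (acc rec) with nonempty? W
    -- The empty graph has `⊥` as its only maximal clique, so lists are never empty; the first
    -- vertex put back is absorbed into `⊥` rather than appended.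
    ... | no empty = [ ⊥ ] , single ⊥ , λ T →
      (λ (T⊆W , _) → here (Empty-unique λ (u , u∈T) → empty (u , T⊆W u∈T))) ,
      λ { (here refl) → (λ u∈⊥ → contradiction u∈⊥ ∉⊥) , (λ _ _ u∈⊥ → contradiction u∈⊥ ∉⊥)
                      , λ x x∈W → contradiction (x , x∈W) empty }
    ... | yes ne with ∃-simplicial G chordal W ne
    ... | v , simplicial with go (W - v) (rec (x∈p⇒p-x⊂p (proj₁ simplicial)))
    ... | L , rip , lists = Removal.restore simplicial rip lists

-- From lists to perfect sequences

module _ {n : ℕ} where

  -- Since the head is the last set of the sequence, a larger index means an earlier position.
  Witness : (M : List (Subset n)) → Fin (length M) → Set
  Witness M i = ∃[ j ] (i Fin.< j × lookup M i ⊈ lookup M j ×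
    (∀ e → i Fin.< e → ∀ {u} → u ∈ lookup M e → u ∈ lookup M i → u ∈ lookup M j))

  -- The bound excludes only the final index, which holds the first set of the sequence.
  witness : ∀ {M} → RunningIntersection M → ∀ i → suc (toℕ i) ℕ.< length M → Witness M i
  witness (single D) zero (s≤s ())
  witness (extend {D} {L} D′ D′∈L D⊈D′ rip r) zero _ =
    suc (index D′∈L) , s≤s z≤n , subst (D ⊈_) D′≡ D⊈D′ , covered
    where
    D′≡ = lookup-index D′∈L
    covered : ∀ e → zero {n = length L} Fin.< e → ∀ {u} → u ∈ lookup (D ∷ L) e → u ∈ D → u ∈ lookup L (index D′∈L)
    covered (suc e) _ u∈E u∈D = subst (_ ∈_) D′≡ (rip (lookup L e) (∈-lookup e) u∈E u∈D)
  witness (extend {D} {L} _ _ _ _ r) (suc i) (s≤s i<) with witness r i i<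
  ... | j , i<j , i⊈j , rip = suc j , s≤s i<j , i⊈j , λ { (suc e) (s≤s i<e) → rip e i<e }

  -- If the two sets agreed, the clause for `e = j` would place the set at `i` inside the container
  -- that its witness provides.
  lookup-≢ : ∀ {M} → RunningIntersection M → ∀ {i j} → i Fin.< j → lookup M i ≢ lookup M j
  lookup-≢ r {i} {j} i<j eq with witness r i (ℕ.<-≤-trans (s≤s i<j) (toℕ<n j))
  ... | _ , _ , i⊈ , rip = i⊈ λ u∈ → rip j i<j (subst (_ ∈_) eq u∈) u∈

  lookup-injective : ∀ {M} → RunningIntersection M → ∀ {i j} → lookup M i ≡ lookup M j → i ≡ j
  lookup-injective r {i} {j} eq with <-cmp i j
  ... | tri< i<j _ _ = contradiction eq (lookup-≢ r i<j)
  ... | tri≈ _ i≡j _ = i≡j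
  ... | tri> _ _ j<i = contradiction (sym eq) (lookup-≢ r j<i)

module _ {n : ℕ} (G : Graph n) {K : ℕ} (𝒞 : Fin K → Subset n) (π : Permutation′ K) where

  ∈-S⁺ : ∀ {k j u} → j Fin.< k → u ∈ 𝒞 (π ⟨$⟩ʳ j) → u ∈ 𝒞 (π ⟨$⟩ʳ k) → u ∈ S G 𝒞 π k
  ∈-S⁺ {k} {j} j<k u∈j u∈k = x∈p∩q⁺
    (∈-⋃⁺ (lose (∈-map⁺ _ (∈-filter⁺ (λ j → j <? k) (∈-allFin j) j<k)) u∈j) , u∈k)

  ∈-S⁻ : ∀ {k u} → u ∈ S G 𝒞 π k →
         (∃[ j ] (j Fin.< k × u ∈ 𝒞 (π ⟨$⟩ʳ j))) × u ∈ 𝒞 (π ⟨$⟩ʳ k)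
  ∈-S⁻ {k} u∈ with x∈p∩q⁻ _ (𝒞 (π ⟨$⟩ʳ k)) u∈
  ... | u∈⋃ , u∈k with find (∈-⋃⁻ _ u∈⋃)
  ... | D , D∈ , u∈D with ∈-map⁻ (λ j → 𝒞 (π ⟨$⟩ʳ j)) D∈
  ... | j , j∈ , refl = (j , proj₂ (∈-filter⁻ (λ j → j <? k) {xs = allFin K} j∈) , u∈D) , u∈k

module _ {n : ℕ} (G : Graph n) {K : ℕ} (𝒞 : Fin K → Subset n) (cliques : MaximalCliques G 𝒞) where

  private
    𝒞-max = proj₁ cliques
    𝒞-injective = proj₁ (proj₂ cliques)
    𝒞-onto = proj₂ (proj₂ cliques)

  -- `opposite` undoes the reversed order of the list. The two maps are mutually inverse because
  -- neither `𝒞` nor `M` has repetitions.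
  enumeration : ∀ {M} → RunningIntersection M → ListsMaximal G ⊤ M →
    ∃[ π ] (∀ i → 𝒞 (π ⟨$⟩ʳ i) ≡ lookup M (opposite i))
  enumeration {M} rip lists = permutation to from to-from from-to , to-spec
    where
    number : ∀ i → ∃[ j ] 𝒞 j ≡ lookup M i
    number i = 𝒞-onto _ (maximalIn⇒maximal G (proj₂ (lists _) (∈-lookup i)))
    place : ∀ j → 𝒞 j ∈ˡ M
    place j = proj₁ (lists _) (maximal⇒maximalIn G (𝒞-max j))
    to : Fin (length M) → Fin K
    to i = proj₁ (number (opposite i))
    from : Fin K → Fin (length M)
    from j = opposite (index (place j))
    to-spec : ∀ i → 𝒞 (to i) ≡ lookup M (opposite i)
    to-spec i = proj₂ (number (opposite i))
    to-from : ∀ j → to (from j) ≡ j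
    to-from j = 𝒞-injective (trans (to-spec (from j))
      (trans (cong (lookup M) (opposite-involutive _)) (sym (lookup-index (place j)))))
    from-to : ∀ i → from (to i) ≡ i
    from-to i = trans (cong opposite (lookup-injective rip
      (trans (sym (lookup-index (place (to i)))) (to-spec i)))) (opposite-involutive i)

  perfectSequence : ∀ {C L} → RunningIntersection (C ∷ L) → ListsMaximal G ⊤ (C ∷ L) →
    ∃[ π ] (PerfectSequence G 𝒞 π × EndsWith G 𝒞 π C)
  perfectSequence {C} {L} rip lists with enumeration rip lists
  -- The bijection forces `K` to be `length M`, which turns `π` into a permutation of a single index
  -- type.
  ... | π , spec with ↔⇒≡ π
  ... | refl = π , perfect , opposite zero , ends
      , trans (spec _) (cong (lookup (C ∷ L)) (opposite-involutive zero))
    where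
    M = C ∷ L
    ends : suc (toℕ (opposite {length M} zero)) ≡ length M
    ends = cong suc (opposite-prop {length M} zero)
    perfect : PerfectSequence G 𝒞 π
    -- `0<k` keeps `opposite k` away from the final index, so the witness exists.
    perfect k 0<k with witness rip (opposite k)
      (subst (λ t → suc t ℕ.< length M) (sym (opposite-prop k)) bound)
      where
      bound : suc (length M ℕ.∸ suc (toℕ k)) ℕ.< length M
      bound = s≤s (ℕ.∸-monoʳ-< 0<k (ℕ.≤-pred (toℕ<n k)))
    ... | j , k<j , k⊈j , covers = clique , opposite j , k′<k , S⊆ , S-proper
      where
      at : ∀ {u i} → u ∈ 𝒞 (π ⟨$⟩ʳ i) → u ∈ lookup M (opposite i)
      at = subst (_ ∈_) (spec _)
      at-j : 𝒞 (π ⟨$⟩ʳ opposite j) ≡ lookup M j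
      at-j = trans (spec _) (cong (lookup M) (opposite-involutive j))
      k′<k : opposite j Fin.< k
      k′<k = subst (opposite j Fin.<_) (opposite-involutive k) (opposite-anti-< k<j)
      clique : Clique G (S G 𝒞 π k)
      clique u w u∈ w∈ = proj₁ (𝒞-max (π ⟨$⟩ʳ k)) u w
        (proj₂ (∈-S⁻ G 𝒞 π u∈)) (proj₂ (∈-S⁻ G 𝒞 π w∈))
      S⊆ : S G 𝒞 π k ⊆ 𝒞 (π ⟨$⟩ʳ opposite j)
      S⊆ u∈ with ∈-S⁻ G 𝒞 π {k} u∈
      ... | (i , i<k , u∈i) , u∈k = subst (_ ∈_) (sym at-j)
        (covers (opposite i) (opposite-anti-< i<k) (at u∈i) (at u∈k))
      -- If the container lay inside the clique at `k`, maximality would make them equal, against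
      -- `k⊈j`. So it has a vertex outside that clique, hence outside `S`.
      S-proper : ∃[ u ] (u ∈ 𝒞 (π ⟨$⟩ʳ opposite j) × u ∉ S G 𝒞 π k)
      S-proper with ⊈⇒∃ {p = 𝒞 (π ⟨$⟩ʳ opposite j)} {q = 𝒞 (π ⟨$⟩ʳ k)} ⊈ₖ
        where
        ⊈ₖ : 𝒞 (π ⟨$⟩ʳ opposite j) ⊈ 𝒞 (π ⟨$⟩ʳ k)
        ⊈ₖ ⊆ₖ = k⊈j (⊆-reflexive (trans (sym (spec k))
          (trans (sym (maximal⇒≡ G (𝒞-max _) (proj₁ (𝒞-max _)) ⊆ₖ)) at-j)))
      ... | u , u∈j , u∉k = u , u∈j , λ u∈S → u∉k (proj₂ (∈-S⁻ G 𝒞 π u∈S))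

-- Simplicial vertices of a maximal clique

module _ {n : ℕ} (G : Graph n) where
  open Graph G renaming (sym to adj-sym)

  ∈-Simp⁺ : ∀ {C v} → v ∈ C → Simplicial G v → v ∈ Simp G C
  ∈-Simp⁺ v∈C simp = x∈p∩q⁺ (v∈C , ∈-comprehension⁺ (simplicial? G) simp)

  ∈-Simp⁻ : ∀ {C v} → v ∈ Simp G C → v ∈ C × Simplicial G v
  ∈-Simp⁻ {C} v∈ = let v∈C , v∈S = x∈p∩q⁻ C _ v∈ in v∈C , ∈-comprehension⁻ (simplicial? G) v∈S

  ∈-Sep⁺ : ∀ {C v} → v ∈ C → v ∉ Simp G C → v ∈ Sep G C
  ∈-Sep⁺ = x∈p∧x∉q⇒x∈p─q

  ∈-Sep⁻ : ∀ {C v} → v ∈ Sep G C → v ∈ C × v ∉ Simp G C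
  ∈-Sep⁻ {C} v∈ = p─q⊆p C (Simp G C) v∈ , x∈p─q⇒x∉q C (Simp G C) v∈

  -- `u` and the members of `C` other than `v` are all neighbours of `v`, hence pairwise adjacent;
  -- so `u` extends `C`.
  adjacent-to-simp : ∀ {C v u} → MaximalClique G C → v ∈ Simp G C → Adj v u → u ∈ C
  adjacent-to-simp {C} {v} {u} max v∈Simp vu = proj₂ (proj₂ (maximal⇒maximalIn G max)) u ∈⊤ extends
    where
    v∈C = proj₁ (∈-Simp⁻ {C} v∈Simp)
    extends : Extends G C u
    extends w w∈C w≢u with w ≟ v
    ... | yes refl = vu
    ... | no w≢v   = proj₂ (∈-Simp⁻ {C} v∈Simp) w u
      (∈-comprehension⁺ (adj? v) (proj₁ max v w v∈C w∈C (≢-sym w≢v)))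
      (∈-comprehension⁺ (adj? v) vu) w≢u

  clique∋simp⇒⊆ : ∀ {C D v} → MaximalClique G C → v ∈ Simp G C → Clique G D → v ∈ D → D ⊆ C
  clique∋simp⇒⊆ {C} {D} {v} max v∈Simp clique v∈D {u} u∈D with v ≟ u
  ... | yes refl = proj₁ (∈-Simp⁻ {C} v∈Simp)
  ... | no v≢u   = adjacent-to-simp max v∈Simp (clique v u v∈D u∈D v≢u)

  maximal∋simp⇒≡ : ∀ {C D v} → MaximalClique G C → v ∈ Simp G C → MaximalClique G D → v ∈ D → D ≡ C
  maximal∋simp⇒≡ maxC v∈Simp maxD v∈D =
    maximal⇒≡ G maxD (proj₁ maxC) (clique∋simp⇒⊆ maxC v∈Simp (proj₁ maxD) v∈D)

  -- Placing a simply separated clique last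

  module SimplySeparatedLast {C C′ s} (maxC : MaximalClique G C) (s∈Simp : s ∈ Simp G C)
    (maxC′ : MaximalClique G C′) (sep : Sep G C ≡ C ∩ C′) where

    W : Subset n
    W = ∁ (Simp G C)

    sep⁺ : ∀ {u} → u ∈ C → u ∈ W → u ∈ C′
    sep⁺ u∈C u∈W = proj₂ (x∈p∩q⁻ C C′ (subst (_ ∈_) sep (∈-Sep⁺ u∈C (x∈∁p⇒x∉p u∈W))))

    -- A simplicial vertex of `C` in `C′` would lie in `C ∩ C′`, which is `Sep G C`.
    C′⊆W : C′ ⊆ W
    C′⊆W {u} u∈C′ = x∉p⇒x∈∁p λ u∈Simp → proj₂ (∈-Sep⁻ {C} (subst (u ∈_) (sym sep)
      (x∈p∩q⁺ (proj₁ (∈-Simp⁻ {C} u∈Simp) , u∈C′)))) u∈Simp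

    C⊈C′ : C ⊈ C′
    C⊈C′ C⊆C′ = x∈∁p⇒x∉p (C′⊆W (C⊆C′ (proj₁ (∈-Simp⁻ {C} s∈Simp)))) s∈Simp

    C′≢C : C′ ≢ C
    C′≢C C′≡C = C⊈C′ (⊆-reflexive (sym C′≡C))

    -- Only some `x` in `Simp G C` could newly extend `T`. Its neighbours lie in `C`, so
    -- `T ⊆ C ∩ W ⊆ C′`; maximality in `W` gives `T ≡ C′`, and then `C′ ⊆ C` forces the excluded
    -- `C′ ≡ C`.
    maximalIn-⊤ : ∀ {T} → MaximalIn G W T → MaximalIn G ⊤ T
    maximalIn-⊤ {T} max@(T⊆W , clique , closed) = ⊆⊤ , clique , closed′
      where
      closed′ : ∀ x → x ∈ ⊤ → Extends G T x → x ∈ T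
      closed′ x _ ext with x ∈? Simp G C
      ... | no x∉Simp  = closed x (x∉p⇒x∈∁p x∉Simp) ext
      ... | yes x∈Simp = contradiction C′≡C C′≢C
        where
        T⊆C : T ⊆ C
        T⊆C {u} u∈T = adjacent-to-simp maxC x∈Simp
          (adj-sym (ext u u∈T λ { refl → x∈∁p⇒x∉p (T⊆W u∈T) x∈Simp }))
        T≡C′ : T ≡ C′
        T≡C′ = maximalIn⇒≡ G max (proj₁ maxC′) C′⊆W λ u∈T → sep⁺ (T⊆C u∈T) (T⊆W u∈T)
        C′≡C : C′ ≡ C
        C′≡C = maximal⇒≡ G maxC′ (proj₁ maxC) (subst (_⊆ C) T≡C′ T⊆C)

    maximalIn-W : ∀ {T} → MaximalIn G ⊤ T → T ≢ C → MaximalIn G W T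
    maximalIn-W {T} max@(_ , clique , closed) T≢C =
      (λ u∈T → x∉p⇒x∈∁p λ u∈Simp → T≢C (maximal∋simp⇒≡ maxC u∈Simp (maximalIn⇒maximal G max) u∈T))
      , clique , λ x _ → closed x ∈⊤

    appendLast : ∀ {L} → RunningIntersection L → ListsMaximal G W L →
                 RunningIntersection (C ∷ L) × ListsMaximal G ⊤ (C ∷ L)
    appendLast {L} rip lists =
      -- All earlier cliques avoid `Simp G C`, so they meet `C` only within `Sep G C`, which is part
      -- of `C′`.
      extend C′ (proj₁ (lists C′) (maximalIn-W (maximal⇒maximalIn G maxC′) C′≢C)) C⊈C′
        (λ E E∈L u∈E u∈C → sep⁺ u∈C (proj₁ (proj₂ (lists E) E∈L) u∈E)) rip
      , λ T → to T , from T
      where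
      to : ∀ T → MaximalIn G ⊤ T → T ∈ˡ C ∷ L
      to T max with T ≟ˢ C
      ... | yes T≡C = here T≡C
      ... | no T≢C  = there (proj₁ (lists T) (maximalIn-W max T≢C))
      from : ∀ T → T ∈ˡ C ∷ L → MaximalIn G ⊤ T
      from T (here refl) = maximal⇒maximalIn G maxC
      from T (there T∈L) = maximalIn-⊤ (proj₂ (lists T) T∈L)

  simplySeparated⇒last : Chordal G → ∀ {K} (𝒞 : Fin K → Subset n) → MaximalCliques G 𝒞 →
    ∀ {C} → SimplySeparated G C → ∃[ π ] (PerfectSequence G 𝒞 π × EndsWith G 𝒞 π C)
  simplySeparated⇒last chordal 𝒞 cliques {C} (maxC , (s , s∈Simp) , C′ , maxC′ , sep)
    with perfectList G chordal (∁ (Simp G C))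
  ... | L , rip , lists =
    let rip′ , lists′ = SimplySeparatedLast.appendLast maxC s∈Simp maxC′ sep rip lists
    in perfectSequence G 𝒞 cliques rip′ lists′

  -- Simple separation of the last clique

  last⇒simplySeparated : ∀ {K} (𝒞 : Fin K → Subset n) → MaximalCliques G 𝒞 → 2 ≤ K →
    ∀ {C} → ∃[ π ] (PerfectSequence G 𝒞 π × EndsWith G 𝒞 π C) → SimplySeparated G C
  -- With at least two cliques the last position is positive, so the perfect sequence supplies a
  -- container `C′` for the last separator.
  last⇒simplySeparated {K} 𝒞 (𝒞-max , 𝒞-injective , 𝒞-onto) 2≤K
    (π , perfect , k , k-last , refl) with perfect k (ℕ.≤-pred (subst (2 ≤_) (sym k-last) 2≤K))
  ... | _ , j , j<k , S⊆ , _ = maxC , simp-nonempty , C′ , 𝒞-max _ , ⊆-antisym sep⊆ ⊆sep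
    where
    C  = 𝒞 (π ⟨$⟩ʳ k)
    C′ = 𝒞 (π ⟨$⟩ʳ j)
    maxC = 𝒞-max (π ⟨$⟩ʳ k)

    C′≢C : C′ ≢ C
    C′≢C C′≡C = ℕ.<⇒≢ j<k (cong toℕ (trans (sym (inverseˡ π))
      (trans (cong (π ⟨$⟩ˡ_) (𝒞-injective C′≡C)) (inverseˡ π))))

    -- The edge lies in a maximal clique `D`. If `D` came before `C`, then `v` would be in the last
    -- separator and so in `C′`; as `k` is the last position, `D` must be `C`.
    adjacent-private : ∀ {v u} → v ∈ C → v ∉ C′ → Adj v u → u ∈ C
    adjacent-private {v} {u} v∈C v∉C′ vu with edge⊆maximal G vu
    ... | D , maxD , v∈D , u∈D with 𝒞-onto D maxD
    ... | i , refl with ℕ.m≤n⇒m<n∨m≡n (ℕ.≤-pred (subst (toℕ (π ⟨$⟩ˡ i) ℕ.<_) (sym k-last) (toℕ<n (π ⟨$⟩ˡ i))))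
    ... | inj₁ i<k = contradiction
      (S⊆ (∈-S⁺ G 𝒞 π i<k (subst (λ i → v ∈ 𝒞 i) (sym (inverseʳ π)) v∈D) v∈C)) v∉C′
    ... | inj₂ i≡k = subst (λ i → u ∈ 𝒞 i)
      (trans (sym (inverseʳ π)) (cong (π ⟨$⟩ʳ_) (toℕ-injective i≡k))) u∈D

    -- All neighbours of such a `v` lie in the clique `C`.
    private⇒simp : ∀ {v} → v ∈ C → v ∉ C′ → v ∈ Simp G C
    private⇒simp {v} v∈C v∉C′ = ∈-Simp⁺ v∈C λ u w u∈ w∈ → proj₁ maxC u w
      (adjacent-private v∈C v∉C′ (∈-comprehension⁻ (adj? v) u∈))
      (adjacent-private v∈C v∉C′ (∈-comprehension⁻ (adj? v) w∈))

    simp-nonempty : Nonempty (Simp G C)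
    simp-nonempty with ⊈⇒∃ {p = C} {q = C′} (λ C⊆C′ → C′≢C (sym (maximal⇒≡ G maxC (proj₁ (𝒞-max _)) C⊆C′)))
    ... | v , v∈C , v∉C′ = v , private⇒simp v∈C v∉C′

    sep⊆ : Sep G C ⊆ C ∩ C′
    sep⊆ {v} v∈ = let v∈C , v∉Simp = ∈-Sep⁻ {C} v∈ in
      x∈p∩q⁺ (v∈C , decidable-stable (v ∈? C′) λ v∉C′ → v∉Simp (private⇒simp v∈C v∉C′))

    ⊆sep : C ∩ C′ ⊆ Sep G C
    ⊆sep v∈ = let v∈C , v∈C′ = x∈p∩q⁻ C C′ v∈ in
      ∈-Sep⁺ v∈C λ v∈Simp → C′≢C (maximal∋simp⇒≡ maxC v∈Simp (𝒞-max _) v∈C′)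

theorem3p3 : ∀ {n : ℕ} (G : Graph n) → Connected G → Chordal G →
    ∀ {K : ℕ} (𝒞 : Fin K → Subset n) → MaximalCliques G 𝒞 → 2 ≤ K →
    ∀ (C : Subset n) → MaximalClique G C →
    SimplySeparated G C ⇔ (∃[ π ] (PerfectSequence G 𝒞 π × EndsWith G 𝒞 π C))
theorem3p3 G _ chordal 𝒞 cliques 2≤K _ _ =
  mk⇔ (simplySeparated⇒last G chordal 𝒞 cliques) (last⇒simplySeparated G 𝒞 cliques 2≤K)
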